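{- Let $\mathcal{T}=(t_i)_{i=0}^\infty$ be the Thue-Morse sequence over $\mathbb{F}_2$. For every integer $N\ge 4$, the $N$th maximum order complexity of $\mathcal{T}$ satisfies $$M(\mathcal{T},N)=2^\ell+1,\qquad\text{where}\qquad \ell=\left\lceil \frac{\log (N/5)}{\log 2}\right\rceil .$$
   Context: The Thue-Morse sequence $\mathcal{T}=(t_i)_{i=0}^\infty$ over the two-element field $\mathbb{F}_2$ is defined by $t_0=0$ and, for $i=1,2,\ldots$, $t_i=t_{i/2}$ if $i$ is even and $t_i=t_{(i-1)/2}+1$ if $i$ is odd (equivalently, $t_i$ is the parity of the sum of binary digits of $i$). For a binary sequence $\mathcal{S}=(s_i)_{i=0}^\infty$ over $\mathbb{F}_2$ and a positive integer $N$, the $N$th maximum order complexity $M(\mathcal{S},N)$ is defined as follows. If $(s_0,\ldots,s_{N-2})$ is not a constant tuple $(a,\ldots,a)$ with $a\in\{0,1\}$, then $M(\mathcal{S},N)$ is the smallest positive integer $M$ such that there is a polynomial $f(x_1,\ldots,x_M)\in\mathbb{F}_2[x_1,\ldots,x_M]$ with $$s_{i+M}=f(s_i,s_{i+1},\ldots,s_{i+M-1}),\quad 0\le i\le N-M-1.$$ If $s_i=a$ for all $i=0,\ldots,N-2$, then $M(\mathcal{S},N)=0$ if $s_{N-1}=a$ and $M(\mathcal{S},N)=N-1$ if $s_{N-1}\ne a$. -}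

module Defs where

open import Algebra.Bundles using (CommutativeRing; Semiring)
open import Data.Bool.Properties using (xor-∧-commutativeRing)
open import Data.Fin.Base using (Fin; toℕ)
open import Data.Integer.Base as ℤ using (ℤ; +_; -[1+_])
open import Data.List.Base using (List; foldr; map)
open import Data.Nat.Base as ℕ using (ℕ; zero; suc; s≤s; _≤_; _<_)
open import Data.Nat.DivMod using (_/_; _%_; m/n≤m; m/n<m)
open import Data.Nat.Induction using (<-rec)
open import Data.Nat.Properties using (_≟_; ≤-refl; m^n≢0)
open import Data.Product.Base using (_×_; _,_; ∃-syntax)
open import Data.Rational.Unnormalised.Base as ℚᵘ using (ℚᵘ)
open import Data.Vec.Functional using (Vector)
open import Level using (Level)
open import Relation.Binary.Core using (Rel)
open import Relation.Binary.PropositionalEquality using (_≡_; _≢_)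
open import Relation.Nullary using (¬_; yes; no)
open import Relation.Unary using (Pred)

-- The field with two elements: addition is _xor_, multiplication is _∧_.
module F₂ = CommutativeRing xor-∧-commutativeRing

open F₂ public using () renaming (Carrier to 𝔽₂)
open F₂ using (_+_; _*_; 0#; 1#)

open import Algebra.Definitions.RawSemiring (Semiring.rawSemiring F₂.semiring) using (_^_; product)

Sequence : Set
Sequence = ℕ → 𝔽₂

thueMorseStep : ∀ i → (∀ {j} → j < i → 𝔽₂) → 𝔽₂
thueMorseStep zero    t = 0#
thueMorseStep (suc i) t with suc i % 2 ≟ 0
... | yes _ = t {suc i / 2} (m/n<m (suc i) 2 ≤-refl)
... | no  _ = t {i / 2} (s≤s (m/n≤m i 2)) + 1#

thueMorse : Sequence
thueMorse = <-rec (λ _ → 𝔽₂) thueMorseStep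

-- A polynomial in m variables is a formal sum of terms c · x₁^e₁ ⋯ xₘ^eₘ.
-- Several terms may share an exponent vector; their coefficients then add up.
Polynomial : ℕ → Set
Polynomial m = List (𝔽₂ × Vector ℕ m)

eval : ∀ {m} → Polynomial m → Vector 𝔽₂ m → 𝔽₂
eval f x = foldr _+_ 0# (map term f)
  where
  term : 𝔽₂ × Vector ℕ _ → 𝔽₂
  term (c , e) = c * product (λ j → x j ^ e j)

-- The range 0 ≤ i ≤ N - m - 1 is written i + m < N, which also makes it empty
-- when N ≤ m.
HasRecurrence : Sequence → ℕ → ℕ → Set
HasRecurrence s N m = ∃[ f ] ∀ i → i ℕ.+ m < N →
  s (i ℕ.+ m) ≡ eval {m} f (λ j → s (i ℕ.+ toℕ j))

IsLeast : ∀ {a r p : Level} {A : Set a} → Rel A r → Pred A p → Pred A _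
IsLeast _≼_ P x = P x × (∀ y → P y → x ≼ y)

AllEqual : Sequence → ℕ → 𝔽₂ → Set
AllEqual s n a = ∀ i → i < n → s i ≡ a

-- IsMaximumOrderComplexity s N m means M(s, N) = m. It is defined for positive
-- N only, so that the initial segment s₀, …, s_{N-2} has length n for N = suc n.
data IsMaximumOrderComplexity (s : Sequence) : ℕ → ℕ → Set where
  nonconstant : ∀ {n m} →
    ¬ (∃[ a ] AllEqual s n a) →
    IsLeast _≤_ (λ k → 0 < k × HasRecurrence s (suc n) k) m →
    IsMaximumOrderComplexity s (suc n) m
  constant-≡ : ∀ {n} a → AllEqual s n a → s n ≡ a →
    IsMaximumOrderComplexity s (suc n) 0
  constant-≢ : ∀ {n} a → AllEqual s n a → s n ≢ a →
    IsMaximumOrderComplexity s (suc n) n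

2^_ : ℤ → ℚᵘ
2^ (+ n)    = + (2 ℕ.^ n) ℚᵘ./ 1
2^ -[1+ n ] = ℚᵘ._/_ (+ 1) (2 ℕ.^ suc n) {{m^n≢0 2 (suc n)}}

-- ℓ = ⌈log q / log 2⌉ for positive q: the ceiling is the least integer k with
-- log q / log 2 ≤ k, and that inequality is q ≤ 2^k.
IsCeilLog₂ : ℚᵘ → ℤ → Set
IsCeilLog₂ q = IsLeast ℤ._≤_ (λ k → q ℚᵘ.≤ 2^ k)

{-# OPTIONS --safe #-}
module Submission where

-- A recurrence of order m on the first N terms exists iff equal windows of
-- length m are followed by equal terms. For t the Thue-Morse sequence,
-- t(2n) = t(n) and t(2n+1) = 1 + t(n), so two equal windows of length 2L + 1
-- that start at positions of equal parity come from equal windows of length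
-- L + 1 at the halved positions; starting at positions of different parity
-- they would force t(a) = t(a+1) = t(a+2) once 2L + 1 ≥ 5. Hence order 2^ℓ + 1
-- suffices for N ≤ 5·2^ℓ by doubling from ℓ = 0, 1. Conversely, in units of
-- 2^(ℓ-1) the sequence begins 0 1 1 0 1 0: the window of length 2^ℓ at 0 recurs
-- at 3·2^(ℓ-1) with a different successor, so order 2^ℓ fails once N > 5·2^(ℓ-1).

open import Algebra.Bundles using (Semiring)
open import Defs
open import Data.Bool.Base using (true; false; not; _∧_; _xor_)
import Data.Bool.Properties as Bool
open import Data.Fin.Base using (Fin; toℕ; fromℕ<)
open import Data.Fin.Properties using (toℕ-fromℕ<; toℕ<n)
open import Data.Integer.Base as ℤ using (+_; -[1+_])
open import Data.Integer.Properties using (drop‿+≤+; pos-*)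
open import Data.List.Base using ([]; _∷_; _++_; map)
open import Data.Nat.Base
  using (ℕ; zero; suc; NonZero; _+_; _*_; _^_; _∸_; _≤_; _<_; z≤n; s≤s)
open import Data.Nat.DivMod
  using (_%_; m*n%n≡0; m*n/n≡m; [m+kn]%n≡m%n; /-congˡ)
open import Data.Nat.Induction using (<-wellFounded)
open import Data.Nat.Properties
open import Data.Nat.Tactic.RingSolver using (solve-∀)
open import Data.Product.Base using (_×_; _,_; ∃-syntax)
open import Data.Rational.Unnormalised.Base as ℚᵘ using (_/_; *≤*)
open import Data.Vec.Base as Vec using (Vec; []; _∷_)
import Data.Vec.Properties as Vec
open import Data.Vec.Functional as Vector using (Vector; head; tail)
open import Function.Base using (_∘_)
open import Induction.WellFounded using (module FixPoint)
open import Relation.Binary.PropositionalEquality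
open import Relation.Nullary
  using (Dec; yes; no; ¬_; contradiction; map′; _×-dec_; _→-dec_)
open import Relation.Nullary.Decidable using (True; toWitness; from-yes; from-no)

-- Polynomials and Boolean functions

module _ where
  open import Algebra.Definitions.RawSemiring (Semiring.rawSemiring F₂.semiring)
    using (product) renaming (_^_ to _^ᶠ_)

  -- Names the product inside the local `term` of `eval`, so that the value of a term can be written
  -- as `c ∧ monomial e x`.
  monomial : ∀ {m} → Vector ℕ m → Vector 𝔽₂ m → 𝔽₂
  monomial e x = product (λ j → x j ^ᶠ e j)

  monomial-cong : ∀ {m} (e : Vector ℕ m) {x y} → x ≗ y → monomial e x ≡ monomial e y
  monomial-cong {zero}  e x≗y = refl
  monomial-cong {suc m} e x≗y =
    cong₂ _∧_ (cong (_^ᶠ head e) (x≗y Fin.zero)) (monomial-cong (tail e) (x≗y ∘ Fin.suc))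

-- Vectors here are functions, so without extensionality pointwise equality has to be carried
-- through the evaluation.
eval-cong : ∀ {m} (f : Polynomial m) {x y} → x ≗ y → eval f x ≡ eval f y
eval-cong []            x≗y = refl
eval-cong ((c , e) ∷ f) x≗y =
  cong₂ _xor_ (cong (c ∧_) (monomial-cong e x≗y)) (eval-cong f x≗y)

eval-++ : ∀ {m} (f g : Polynomial m) x → eval (f ++ g) x ≡ eval f x xor eval g x
eval-++ []            g x = refl
eval-++ ((c , e) ∷ f) g x =
  trans (cong ((c ∧ monomial e x) xor_) (eval-++ f g x))
        (sym (Bool.xor-assoc (c ∧ monomial e x) (eval f x) (eval g x)))

scaleHead : ∀ {m} → ℕ → Polynomial m → Polynomial (suc m)
scaleHead k = map λ (c , e) → c , (k Vector.∷ e)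

eval-scaleHead-0 : ∀ {m} (f : Polynomial m) x → eval (scaleHead 0 f) x ≡ eval f (tail x)
eval-scaleHead-0 []            x = refl
eval-scaleHead-0 ((c , e) ∷ f) x =
  cong ((c ∧ monomial e (tail x)) xor_) (eval-scaleHead-0 f x)

eval-scaleHead-1 : ∀ {m} (f : Polynomial m) x →
  eval (scaleHead 1 f) x ≡ head x ∧ eval f (tail x)
eval-scaleHead-1 []            x = sym (Bool.∧-zeroʳ (head x))
eval-scaleHead-1 ((c , e) ∷ f) x with head x | eval-scaleHead-1 f x
... | true  | ih = cong ((c ∧ monomial e (tail x)) xor_) ih
... | false | ih = cong₂ _xor_ (Bool.∧-zeroʳ c) ih

-- g(x₀, …) = g(0, …) + x₀ (g(0, …) + g(1, …)).
interpolate : ∀ {m} → (Vec 𝔽₂ m → 𝔽₂) → Polynomial m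
interpolate {zero}  g = (g [] , λ ()) ∷ []
interpolate {suc m} g =
  scaleHead 0 (interpolate (g ∘ (false ∷_))) ++
  scaleHead 1 (interpolate (g ∘ (false ∷_)) ++ interpolate (g ∘ (true ∷_)))

eval-interpolate : ∀ {m} (g : Vec 𝔽₂ m → 𝔽₂) x →
  eval (interpolate g) x ≡ g (Vec.tabulate x)
eval-interpolate {zero}  g x =
  trans (Bool.xor-identityʳ _) (Bool.∧-identityʳ (g []))
eval-interpolate {suc m} g x = begin
  eval (scaleHead 0 f₀ ++ scaleHead 1 (f₀ ++ f₁)) x
    ≡⟨ eval-++ (scaleHead 0 f₀) _ x ⟩
  eval (scaleHead 0 f₀) x xor eval (scaleHead 1 (f₀ ++ f₁)) x
    ≡⟨ cong₂ _xor_ (eval-scaleHead-0 f₀ x) (eval-scaleHead-1 (f₀ ++ f₁) x) ⟩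
  eval f₀ y xor (head x ∧ eval (f₀ ++ f₁) y)
    ≡⟨ cong (λ z → eval f₀ y xor (head x ∧ z)) (eval-++ f₀ f₁ y) ⟩
  eval f₀ y xor (head x ∧ (eval f₀ y xor eval f₁ y))
    ≡⟨ cong₂ (λ a b → a xor (head x ∧ (a xor b)))
         (eval-interpolate (g ∘ (false ∷_)) y) (eval-interpolate (g ∘ (true ∷_)) y) ⟩
  g (false ∷ ys) xor (head x ∧ (g (false ∷ ys) xor g (true ∷ ys)))
    ≡⟨ select (head x) ⟩
  g (head x ∷ ys) ∎
  where
  open ≡-Reasoning
  y  = tail x
  ys = Vec.tabulate y
  f₀ = interpolate (g ∘ (false ∷_))
  f₁ = interpolate (g ∘ (true ∷_))
  select : ∀ b → g (false ∷ ys) xor (b ∧ (g (false ∷ ys) xor g (true ∷ ys))) ≡ g (b ∷ ys)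
  select false = Bool.xor-identityʳ _
  select true  = trans (sym (Bool.xor-assoc (g (false ∷ ys)) _ _))
    (cong (_xor g (true ∷ ys)) (Bool.xor-same (g (false ∷ ys))))

-- Recurrences and repeated windows

Determined : Sequence → ℕ → ℕ → Set
Determined s N m = ∀ i j → i + m < N → j + m < N →
  (∀ k → k < m → s (i + k) ≡ s (j + k)) → s (i + m) ≡ s (j + m)

-- Every quantifier can be bounded: `i + m < N` forces `i < N`. Small instances are then settled by
-- computation.
determined? : ∀ s N m → Dec (Determined s N m)
determined? s N m = map′
  (λ d i j i+m<N j+m<N eq → d (<-≤-trans (s≤s (m≤m+n i m)) i+m<N)
    (<-≤-trans (s≤s (m≤m+n j m)) j+m<N) i+m<N j+m<N (λ {k} → eq k))
  (λ d {i} _ {j} _ i+m<N j+m<N eq → d i j i+m<N j+m<N (λ k → eq {k}))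
  (allUpTo? (λ i → allUpTo? (λ j →
    (i + m <? N) →-dec ((j + m <? N) →-dec
      (allUpTo? (λ k → s (i + k) Bool.≟ s (j + k)) m →-dec
        (s (i + m) Bool.≟ s (j + m))))) N) N)

Determined-≥ : ∀ {s M N m} → M ≤ N → Determined s N m → Determined s M m
Determined-≥ M≤N d i j i+m<M j+m<M = d i j (<-≤-trans i+m<M M≤N) (<-≤-trans j+m<M M≤N)

-- The last `k` entries of a window of length `m` form a window of length `k` with the same
-- successor; it starts `m ∸ k` places later.
Determined-≤ : ∀ {s N k m} → k ≤ m → Determined s N k → Determined s N m
Determined-≤ {s} {N} {k} {m} k≤m d i j i+m<N j+m<N eq =
  subst₂ (λ x y → s x ≡ s y) (shift i) (shift j)
    (d (i + (m ∸ k)) (j + (m ∸ k))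
      (subst (_< N) (sym (shift i)) i+m<N) (subst (_< N) (sym (shift j)) j+m<N)
      λ l l<k → subst₂ (λ x y → s x ≡ s y) (sym (+-assoc i (m ∸ k) l)) (sym (+-assoc j (m ∸ k) l))
        (eq (m ∸ k + l) (subst (m ∸ k + l <_) (m∸n+n≡m k≤m) (+-monoʳ-< (m ∸ k) l<k))))
  where
  shift : ∀ i → i + (m ∸ k) + k ≡ i + m
  shift i = trans (+-assoc i (m ∸ k) k) (cong (_+_ i) (m∸n+n≡m k≤m))

recurrence⇒determined : ∀ {s N m} → HasRecurrence s N m → Determined s N m
recurrence⇒determined (f , rec) i j i+m<N j+m<N eq =
  trans (rec i i+m<N) (trans (eval-cong f (λ k → eq (toℕ k) (toℕ<n k))) (sym (rec j j+m<N)))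

-- The successor is a function of the window, found by searching for an occurrence; interpolation
-- turns this function into a polynomial.
determined⇒recurrence : ∀ {s N m} → Determined s N m → HasRecurrence s N m
determined⇒recurrence {s} {N} {m} d =
  interpolate next , λ i i+m<N → sym (trans (eval-interpolate next _) (next-window i i+m<N))
  where
  window : ℕ → Vec 𝔽₂ m
  window i = Vec.tabulate λ j → s (i + toℕ j)

  occurrence? : ∀ v → Dec (∃[ i ] i < N × (i + m < N × window i ≡ v))
  occurrence? v = anyUpTo? (λ i → (i + m <? N) ×-dec Vec.≡-dec Bool._≟_ (window i) v) N

  next : Vec 𝔽₂ m → 𝔽₂
  next v with occurrence? v
  ... | yes (i , _) = s (i + m)
  -- An arbitrary value, for words that never occur as a window with a successor among the first `N`
  -- terms.
  ... | no  _       = false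

  window-injective : ∀ i j → window i ≡ window j → ∀ k → k < m → s (i + k) ≡ s (j + k)
  window-injective i j eq k k<m = begin
    s (i + k)                             ≡⟨ at i ⟨
    Vec.lookup (window i) (fromℕ< k<m)    ≡⟨ cong (λ v → Vec.lookup v (fromℕ< k<m)) eq ⟩
    Vec.lookup (window j) (fromℕ< k<m)    ≡⟨ at j ⟩
    s (j + k)                             ∎
    where
    open ≡-Reasoning
    at : ∀ i → Vec.lookup (window i) (fromℕ< k<m) ≡ s (i + k)
    at i = trans (Vec.lookup∘tabulate _ (fromℕ< k<m))
                 (cong (λ x → s (i + x)) (toℕ-fromℕ< k<m))

  next-window : ∀ i → i + m < N → next (window i) ≡ s (i + m)
  next-window i i+m<N with occurrence? (window i)
  ... | yes (j , _ , j+m<N , eq) = d j i j+m<N i+m<N (window-injective j i eq)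
  ... | no ∄occ = contradiction
    (i , <-≤-trans (s≤s (m≤m+n i m)) i+m<N , i+m<N , refl) ∄occ

-- The Thue-Morse sequence

-- The extensionality condition under which well-founded recursion satisfies its unfolding equation.
thueMorseStep-ext : ∀ i {t t′ : ∀ {j} → j < i → 𝔽₂} →
  (∀ {j} (j<i : j < i) → t j<i ≡ t′ j<i) → thueMorseStep i t ≡ thueMorseStep i t′
thueMorseStep-ext zero    eq = refl
thueMorseStep-ext (suc i) eq with suc i % 2 ≟ 0
... | yes _ = eq _
... | no  _ = cong (_xor true) (eq _)

thueMorse-unfold : ∀ i → thueMorse i ≡ thueMorseStep i (λ {j} _ → thueMorse j)
thueMorse-unfold i =
  FixPoint.unfold-wfRec <-wellFounded (λ _ → 𝔽₂) thueMorseStep thueMorseStep-ext {i}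

thueMorse-even : ∀ n → thueMorse (2 * n) ≡ thueMorse n
thueMorse-even n = subst (λ x → thueMorse x ≡ thueMorse n) (*-comm n 2) (go (n * 2) refl)
  where
  -- A variable index can be split into `zero` and `suc`, which `thueMorseStep` needs in order to
  -- compute.
  go : ∀ i → i ≡ n * 2 → thueMorse i ≡ thueMorse n
  go zero    eq = cong thueMorse (*-cancelʳ-≡ 0 n 2 eq)
  go (suc i) eq = trans (thueMorse-unfold (suc i)) step
    where
    step : thueMorseStep (suc i) (λ {j} _ → thueMorse j) ≡ thueMorse n
    step with suc i % 2 ≟ 0
    ... | yes _ = cong thueMorse (trans (/-congˡ eq) (m*n/n≡m n 2))
    ... | no ≢0 = contradiction (trans (cong (_% 2) eq) (m*n%n≡0 n 2)) ≢0

thueMorse-odd : ∀ n → thueMorse (1 + 2 * n) ≡ not (thueMorse n)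
thueMorse-odd n = subst (λ x → thueMorse (suc x) ≡ not (thueMorse n)) (*-comm n 2)
  (trans (thueMorse-unfold (1 + n * 2)) step)
  where
  step : thueMorseStep (1 + n * 2) (λ {j} _ → thueMorse j) ≡ not (thueMorse n)
  step with (1 + n * 2) % 2 ≟ 0
  ... | yes ≡0 = contradiction (trans (sym ([m+kn]%n≡m%n 1 n 2)) ≡0) λ ()
  ... | no  _  = trans (cong (λ x → thueMorse x xor true) (m*n/n≡m n 2))
                       (trans (Bool.xor-comm (thueMorse n) true) (Bool.true-xor _))

even+even : ∀ m n → thueMorse (2 * m + 2 * n) ≡ thueMorse (m + n)
even+even m n = trans (cong thueMorse (sym (*-distribˡ-+ 2 m n))) (thueMorse-even (m + n))

odd+even : ∀ m n → thueMorse (1 + 2 * m + 2 * n) ≡ not (thueMorse (m + n))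
odd+even m n = trans (cong (thueMorse ∘ suc) (sym (*-distribˡ-+ 2 m n))) (thueMorse-odd (m + n))

even+odd : ∀ m n → thueMorse (2 * m + (1 + 2 * n)) ≡ not (thueMorse (m + n))
even+odd m n = trans (cong thueMorse (+-suc (2 * m) (2 * n))) (odd+even m n)

odd+odd≡2* : ∀ m n → 1 + 2 * m + (1 + 2 * n) ≡ 2 * (m + (1 + n))
odd+odd≡2* = solve-∀

odd+odd : ∀ m n → thueMorse (1 + 2 * m + (1 + 2 * n)) ≡ thueMorse (m + (1 + n))
odd+odd m n = trans (cong thueMorse (odd+odd≡2* m n)) (thueMorse-even (m + (1 + n)))

-- Halving repeated windows

data Parity : ℕ → Set where
  even : ∀ n → Parity (2 * n)
  odd  : ∀ n → Parity (1 + 2 * n)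

parity : ∀ n → Parity n
parity zero    = even 0
parity (suc n) with parity n
... | even m = odd m
... | odd  m = subst Parity (*-suc 2 m) (even (suc m))

-- Three consecutive positions contain a pair 2n, 2n + 1, on which the values are complementary: the
-- first two if `a` is even, the last two if `a` is odd.
thueMorse-no-cube : ∀ a → thueMorse (a + 0) ≡ thueMorse (a + 1) →
  thueMorse (a + 1) ≢ thueMorse (a + 2)
thueMorse-no-cube a p q with parity a
... | even n = Bool.not-¬ refl (trans (sym (even+even n 0)) (trans p (even+odd n 0)))
... | odd n  = Bool.not-¬ refl (trans (sym (odd+odd n 0)) (trans q (odd+even n 1)))

-- In the window at 1 + 2b, offsets 1, 2 and offsets 3, 4 are complementary pairs. In the window at
-- 2a the same offsets carry 1 + t(a), t(a+1) and 1 + t(a+1), t(a+2), so t(a) = t(a+1) = t(a+2).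
thueMorse-synchronised : ∀ a b →
  ¬ (∀ k → k < 5 → thueMorse (2 * a + k) ≡ thueMorse (1 + 2 * b + k))
thueMorse-synchronised a b eq = thueMorse-no-cube a
  (cancel (at 1 (even+odd a 0) (odd+odd b 0)) (at 2 (even+even a 1) (odd+even b 1)))
  (cancel (at 3 (even+odd a 1) (odd+odd b 1)) (at 4 (even+even a 2) (odd+even b 2)))
  where
  at : ∀ k {k<5 : True (k <? 5)} {x y} →
    thueMorse (2 * a + k) ≡ x → thueMorse (1 + 2 * b + k) ≡ y → x ≡ y
  at k {k<5} l r = trans (sym l) (trans (eq k (toWitness k<5)) r)

  cancel : ∀ {x y z} → not x ≡ y → z ≡ not y → x ≡ z
  cancel refl refl = sym (Bool.not-involutive _)

determined-double : ∀ {N L} → 2 ≤ L → Determined thueMorse N (1 + L) →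
  Determined thueMorse (2 * N) (1 + 2 * L)
determined-double {N} {L} 2≤L d i j i+m<2N j+m<2N eq with parity i | parity j
-- The successor at 2(a + L) + 1 is the complement of the last entry of the window, at 2(a + L).
... | even a | even b = trans (even+odd a L) (trans (cong not eqL) (sym (even+odd b L)))
  where
  eqL : thueMorse (a + L) ≡ thueMorse (b + L)
  eqL = trans (sym (even+even a L)) (trans (eq (2 * L) ≤-refl) (even+even b L))
-- Offsets 2k with k ≤ L carry the complements of the windows of length L + 1 at `a` and `b`; the
-- successor, at 2(a + L + 1), equals theirs.
... | odd a  | odd b  = trans (odd+odd a L) (trans
  (d a b (halve a i+m<2N) (halve b j+m<2N) λ k k<1+L → Bool.not-injective
    (trans (sym (odd+even a k))
      (trans (eq (2 * k) (s≤s (*-monoʳ-≤ 2 (≤-pred k<1+L)))) (odd+even b k))))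
  (sym (odd+odd b L)))
  where
  halve : ∀ a → 1 + 2 * a + (1 + 2 * L) < 2 * N → a + (1 + L) < N
  halve a lt = *-cancelˡ-< 2 _ _ (subst (_< 2 * N) (odd+odd≡2* a L) lt)
... | even a | odd b  = contradiction
  (λ k k<5 → eq k (<-≤-trans k<5 (s≤s (*-monoʳ-≤ 2 2≤L)))) (thueMorse-synchronised a b)
... | odd a  | even b = contradiction
  (λ k k<5 → sym (eq k (<-≤-trans k<5 (s≤s (*-monoʳ-≤ 2 2≤L))))) (thueMorse-synchronised b a)

determined-2^ : ∀ ℓ → Determined thueMorse (2 ^ ℓ * 5) (1 + 2 ^ ℓ)
-- Doubling requires 2^ℓ ≥ 2, so it cannot lead from ℓ = 0 to ℓ = 1; both cases are decided by
-- computation.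
determined-2^ 0 = from-yes (determined? thueMorse 5 2)
determined-2^ 1 = from-yes (determined? thueMorse 10 3)
determined-2^ (suc ℓ@(suc k)) =
  subst (λ N → Determined thueMorse N (1 + 2 * 2 ^ ℓ)) (sym (*-assoc 2 (2 ^ ℓ) 5))
    (determined-double (*-monoʳ-≤ 2 (m^n>0 2 k)) (determined-2^ ℓ))

-- A repeated window with two different successors

thueMorse-*2^ : ∀ e a → thueMorse (2 ^ e * a) ≡ thueMorse a
thueMorse-*2^ zero    a = cong thueMorse (*-identityˡ a)
thueMorse-*2^ (suc e) a = trans (cong thueMorse (*-assoc 2 (2 ^ e) a))
  (trans (thueMorse-even (2 ^ e * a)) (thueMorse-*2^ e a))

-- Blocks 0, 1 and blocks 3, 4 of length 2^e agree because t(0) = t(3) and t(1) = t(4). Halving `k`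
-- reduces the claim to these two equations.
thueMorse-block-3 : ∀ e k → k < 2 ^ suc e → thueMorse k ≡ thueMorse (2 ^ e * 3 + k)
thueMorse-block-3 zero    0 _ = refl
thueMorse-block-3 zero    1 _ = refl
thueMorse-block-3 zero    (suc (suc k)) (s≤s (s≤s ()))
thueMorse-block-3 (suc e) k k<2^ with parity k | *-assoc 2 (2 ^ e) 3
... | even n | eq = begin
  thueMorse (2 * n)                          ≡⟨ thueMorse-even n ⟩
  thueMorse n                                ≡⟨ thueMorse-block-3 e n (*-cancelˡ-< 2 _ _ k<2^) ⟩
  thueMorse (2 ^ e * 3 + n)                  ≡⟨ even+even (2 ^ e * 3) n ⟨
  thueMorse (2 * (2 ^ e * 3) + 2 * n)        ≡⟨ cong (λ x → thueMorse (x + 2 * n)) eq ⟨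
  thueMorse (2 ^ suc e * 3 + 2 * n)          ∎
  where open ≡-Reasoning
... | odd n  | eq = begin
  thueMorse (1 + 2 * n)                      ≡⟨ thueMorse-odd n ⟩
  not (thueMorse n)                          ≡⟨ cong not (thueMorse-block-3 e n
                                                  (*-cancelˡ-< 2 _ _ (<-trans (n<1+n _) k<2^))) ⟩
  not (thueMorse (2 ^ e * 3 + n))            ≡⟨ even+odd (2 ^ e * 3) n ⟨
  thueMorse (2 * (2 ^ e * 3) + (1 + 2 * n))  ≡⟨ cong (λ x → thueMorse (x + (1 + 2 * n))) eq ⟨
  thueMorse (2 ^ suc e * 3 + (1 + 2 * n))    ∎
  where open ≡-Reasoning

-- The equal windows at 0 and 3·2^e are followed by t(2·2^e) = t(2) = 1 and t(5·2^e) = t(5) = 0. The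
-- bound on `N` puts position 5·2^e in range.
undetermined-2^ : ∀ e {N} → 2 ^ e * 5 < N → ¬ Determined thueMorse N (2 ^ suc e)
undetermined-2^ e {N} 5·2^e<N d = contradiction
  (trans (sym (trans (cong thueMorse (*-comm 2 (2 ^ e))) (thueMorse-*2^ e 2)))
    (trans (d 0 (2 ^ e * 3)
        (≤-<-trans (≤-trans (m≤n+m _ (2 ^ e * 3)) (≤-reflexive 3+2)) 5·2^e<N)
        (subst (_< N) (sym 3+2) 5·2^e<N)
        (thueMorse-block-3 e))
      (trans (cong thueMorse 3+2) (thueMorse-*2^ e 5))))
  λ ()
  where
  3+2 : 2 ^ e * 3 + 2 ^ suc e ≡ 2 ^ e * 5
  3+2 = trans (cong (_+_ (2 ^ e * 3)) (*-comm 2 (2 ^ e))) (sym (*-distribˡ-+ (2 ^ e) 3 2))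

-- In 0 1 1 0 the symbol 1 is followed once by 1 and once by 0.
undetermined-1 : ∀ {N} → 4 ≤ N → ¬ Determined thueMorse N 1
undetermined-1 4≤N d = contradiction
  (d 1 2 (<-≤-trans (s≤s (s≤s (s≤s z≤n))) 4≤N) 4≤N λ { zero _ → refl ; (suc _) (s≤s ()) }) λ ()

-- The exponent ℓ

-- N > 5·2^(ℓ-1), vacuous at ℓ = 0 because N ≥ 4 already gives ⌈log₂(N/5)⌉ ≥ 0.
data Exceeds (N : ℕ) : ℕ → Set where
  zero : Exceeds N 0
  suc  : ∀ {ℓ} → 2 ^ ℓ * 5 < N → Exceeds N (suc ℓ)

exponent : ∀ N → ∃[ ℓ ] N ≤ 2 ^ ℓ * 5 × Exceeds N ℓ
-- The exponent `N` is large enough to start from, as N < 2^N; lowering it while the bound persists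
-- stops at the least one.
exponent N = descend N (≤-trans (<⇒≤ (n<2^n N)) (m≤m*n (2 ^ N) 5))
  where
  n<2^n : ∀ n → n < 2 ^ n
  n<2^n zero    = s≤s z≤n
  n<2^n (suc n) = +-mono-≤ (m^n>0 2 n) (≤-trans (n<2^n n) (m≤m+n _ 0))

  descend : ∀ ℓ → N ≤ 2 ^ ℓ * 5 → ∃[ ℓ ] N ≤ 2 ^ ℓ * 5 × Exceeds N ℓ
  descend zero    N≤ = 0 , N≤ , zero
  descend (suc ℓ) N≤ with N ≤? 2 ^ ℓ * 5
  ... | yes N≤′ = descend ℓ N≤′
  ... | no  N≰  = suc ℓ , N≤ , suc (≰⇒> N≰)

exponent-minimal : ∀ {N ℓ n} → Exceeds N ℓ → N ≤ 2 ^ n * 5 → ℓ ≤ n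
exponent-minimal zero              _  = z≤n
exponent-minimal (suc {ℓ} 5·2^ℓ<N) N≤ = ≰⇒> λ n≤ℓ →
  <⇒≱ 5·2^ℓ<N (≤-trans N≤ (*-monoˡ-≤ 5 (^-monoʳ-≤ 2 n≤ℓ)))

-- Rules out negative exponents, where 2^k = 1/d with d ≥ 2: cross-multiplying would give 8 ≤ N·d ≤
-- 5.
N/5≰1/d : ∀ {N} d .{{_ : NonZero d}} → 4 ≤ N → 2 ≤ d → ¬ (+ N / 5 ℚᵘ.≤ + 1 / d)
N/5≰1/d {N} d@(suc _) 4≤N 2≤d (*≤* le) = contradiction
  (≤-trans (*-mono-≤ 4≤N 2≤d) (drop‿+≤+ (subst (ℤ._≤ + 5) (sym (pos-* N d)) le)))
  (from-no (8 ≤? 5))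

isCeilLog₂ : ∀ {N ℓ} → 4 ≤ N → N ≤ 2 ^ ℓ * 5 → Exceeds N ℓ → IsCeilLog₂ (+ N / 5) (+ ℓ)
isCeilLog₂ {N} {ℓ} 4≤N N≤ exceeds =
  *≤* (subst₂ ℤ._≤_ (pos-* N 1) (pos-* (2 ^ ℓ) 5)
    (ℤ.+≤+ (subst (_≤ 2 ^ ℓ * 5) (sym (*-identityʳ N)) N≤))) , minimal
  where
  minimal : ∀ k → + N / 5 ℚᵘ.≤ 2^ k → + ℓ ℤ.≤ k
  minimal (+ n)    (*≤* le) = ℤ.+≤+ (exponent-minimal exceeds (subst (_≤ 2 ^ n * 5) (*-identityʳ N)
    (drop‿+≤+ (subst₂ ℤ._≤_ (sym (pos-* N 1)) (sym (pos-* (2 ^ n) 5)) le))))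
  minimal -[1+ n ] le = contradiction le
    (N/5≰1/d (2 ^ suc n) {{m^n≢0 2 (suc n)}} 4≤N (*-monoʳ-≤ 2 (m^n>0 2 n)))

-- The complexity of the initial segments

undetermined : ∀ {N ℓ} → 4 ≤ N → Exceeds N ℓ → ¬ Determined thueMorse N (2 ^ ℓ)
undetermined 4≤N zero              = undetermined-1 4≤N
undetermined 4≤N (suc {ℓ} 5·2^ℓ<N) = undetermined-2^ ℓ 5·2^ℓ<N

isMaximumOrderComplexity : ∀ {N ℓ} → 4 ≤ N → N ≤ 2 ^ ℓ * 5 → Exceeds N ℓ →
  IsMaximumOrderComplexity thueMorse N (1 + 2 ^ ℓ)
isMaximumOrderComplexity {suc n} {ℓ} 4≤N N≤ exceeds = nonconstant
  -- The first two terms already differ: t(0) = 0 and t(1) = 1.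
  (λ (a , eq) → contradiction
    (trans (eq 0 (<-≤-trans (s≤s z≤n) 3≤n)) (sym (eq 1 (<-≤-trans (s≤s (s≤s z≤n)) 3≤n)))) λ ())
  ( (s≤s z≤n , determined⇒recurrence {thueMorse} (Determined-≥ {thueMorse} N≤ (determined-2^ ℓ)))
  -- Only order 2^ℓ is refuted directly; a recurrence of smaller order would make 2^ℓ determined
  -- too.
  , λ k (_ , rec) → ≰⇒> λ k≤2^ℓ →
      undetermined 4≤N exceeds (Determined-≤ {thueMorse} k≤2^ℓ (recurrence⇒determined {thueMorse} rec)) )
  where
  3≤n : 3 ≤ n
  3≤n = ≤-pred 4≤N

theorem1 : ∀ (N : ℕ) → 4 ≤ N →
    ∃[ ℓ ] IsCeilLog₂ (+ N / 5) (+ ℓ) × IsMaximumOrderComplexity thueMorse N (2 ^ ℓ + 1)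
theorem1 N 4≤N with exponent N
... | ℓ , N≤ , exceeds = ℓ , isCeilLog₂ 4≤N N≤ exceeds ,
  subst (IsMaximumOrderComplexity thueMorse N) (+-comm 1 (2 ^ ℓ))
    (isMaximumOrderComplexity 4≤N N≤ exceeds)
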